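{- Let $\sigma\in\mathcal{S}_k$ and $\tau\in\mathcal{S}_n$ with $\sigma\le\tau$ (i.e. $\tau$ contains $\sigma$ as a pattern), and fix an occurrence $\langle\sigma\rangle$ of $\sigma$ in $\tau$. If the pair $(\langle\sigma\rangle,\tau)$ has an interval block, then $\mu(\langle\sigma\rangle,\tau)=0$, where $\mu(\langle\sigma\rangle,\tau)$ is the Möbius function of the occurrence poset $[\langle\sigma\rangle,\tau]$ evaluated between its minimum and maximum elements.
   Context: Permutations are written in one-line notation. Two sequences of distinct integers are order isomorphic if their letters are in the same relative order of size. $\tau$ contains $\sigma$ if some subsequence $\tau(i_1)\cdots\tau(i_k)$ ($i_1<\dots<i_k$) is order isomorphic to $\sigma$; such a subsequence is an occurrence of $\sigma$ in $\tau$. An interval block of $\tau$ is a factor (consecutive substring) $\tau(a)\tau(a+1)\cdots\tau(a+b)$ with $b\ge 1$ whose set of values is $\{a',a'+1,\dots,a'+b\}$ for some $a'$. The pair $(\langle\sigma\rangle,\tau)$ has an interval block if $\tau$ has an interval block containing no letter of the occurrence $\langle\sigma\rangle$; otherwise the pair is interval free. Occurrence poset: let $C$ be the set of letters of $\tau$ not in $\langle\sigma\rangle$. For $S\subseteq C$, let $\langle\sigma\rangle+S$ denote the subsequence of $\tau$ consisting of the letters of $\langle\sigma\rangle$ and of $S$, recorded as its standard form (the order-isomorphic permutation of $\{1,\dots,k+|S|\}$) together with the set of positions occupied by the letters of $\langle\sigma\rangle$. Two subsets give the same element if they give the same standard form and the same set of marked positions. The elements of $[\langle\sigma\rangle,\tau]$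 are these objects, ordered by: $\rho\le\pi$ iff $\rho$ is obtained from $\pi$ by deleting some letters of $\pi$ not in the marked occurrence (equivalently $\rho=\langle\sigma\rangle+S$, $\pi=\langle\sigma\rangle+S'$ for some $S\subseteq S'$). Its minimum is $\langle\sigma\rangle$ ($S=\emptyset$) and its maximum is $\tau$ ($S=C$). The Möbius function of a poset is defined by $\mu(s,s)=1$ and $\mu(s,t)=-\sum_{s\le x<t}\mu(s,x)$ for $s<t$. -}

module Defs where

open import Data.Nat using (ℕ; zero; suc; _+_; _<_; _≤_; _<ᵇ_)
open import Data.Nat.Properties using () renaming (_≟_ to _≟ℕ_)
open import Data.Bool using (Bool; true; false; _∧_; _∨_; not; if_then_else_)
open import Data.Bool.Properties using () renaming (_≟_ to _≟𝔹_)
open import Data.Fin using (Fin; toℕ)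
open import Data.Fin.Properties using () renaming (_≟_ to _≟F_)
open import Data.Fin.Subset using (Subset; _⊆_; ∁; ⊥)
open import Data.Vec using (Vec; []; _∷_; lookup; tabulate)
open import Data.List using (List; []; _∷_; map; concatMap; filterᵇ; allFin; length; zip; deduplicate; foldr)
open import Data.Bool.ListAction using (any)
import Data.List.Properties as LP
import Data.Product.Properties as PP
open import Data.Product using (_×_; _,_; Σ; ∃; ∃-syntax)
open import Data.Integer using (ℤ; -_) renaming (_+_ to _+ℤ_)
open import Relation.Binary using (DecidableEquality)
open import Relation.Nullary using (¬_; does)
open import Relation.Nullary.Decidable using (⌊_⌋)
open import Function using (_⇔_)
open import Relation.Binary.PropositionalEquality using (_≡_)

-- Permutations in one-line notation.
-- A permutation in S_n is written as a function τ : Fin n → ℕ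
-- (τ(i) is the (i+1)-th letter); its values are exactly {0,…,n-1}
-- (0-based convention instead of {1,…,n}).

IsPerm : (n : ℕ) → (Fin n → ℕ) → Set
IsPerm n τ = (∀ i → τ i < n) × (∀ i j → τ i ≡ τ j → i ≡ j)

IsOccurrence : {k n : ℕ} → (Fin k → ℕ) → (Fin n → ℕ) → (Fin k → Fin n) → Set
IsOccurrence σ τ ι =
  (∀ a b → toℕ a < toℕ b → toℕ (ι a) < toℕ (ι b)) ×
  (∀ a b → (σ a < σ b) ⇔ (τ (ι a) < τ (ι b)))

marked : {k n : ℕ} → (Fin k → Fin n) → Fin n → Bool
marked {k} ι i = any (λ a → ⌊ ι a ≟F i ⌋) (allFin k)

InRange : {n : ℕ} → ℕ → ℕ → Fin n → Set
InRange a b i = a ≤ toℕ i × toℕ i ≤ a + b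

IsIntervalBlock : {n : ℕ} → (Fin n → ℕ) → ℕ → ℕ → Set
IsIntervalBlock {n} τ a b =
  1 ≤ b × a + b < n ×
  ∃[ a' ] ((∀ i → InRange a b i → (a' ≤ τ i × τ i ≤ a' + b)) ×
           (∀ v → a' ≤ v → v ≤ a' + b → ∃[ i ] (InRange a b i × τ i ≡ v)))

HasIntervalBlock : {k n : ℕ} → (Fin n → ℕ) → (Fin k → Fin n) → Set
HasIntervalBlock τ ι =
  ∃[ a ] ∃[ b ] (IsIntervalBlock τ a b ×
                 (∀ i → InRange a b i → marked ι i ≡ false))

std : List ℕ → List ℕ
std xs = map (λ x → length (filterᵇ (λ y → y <ᵇ x) xs)) xs

-- Elements of the occurrence poset: the standard form of the
-- subsequence, each letter tagged with whether it belongs to ⟨σ⟩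
-- (this records exactly the standard form together with the set of
-- marked positions).

Obj : Set
Obj = List (ℕ × Bool)

_≟Obj_ : DecidableEquality Obj
_≟Obj_ = LP.≡-dec (PP.≡-dec _≟ℕ_ _≟𝔹_)

occPlus : {k n : ℕ} → (Fin n → ℕ) → (Fin k → Fin n) → Subset n → Obj
occPlus {k} {n} τ ι S =
  let pos = filterᵇ (λ i → lookup S i ∨ marked ι i) (allFin n)
  in zip (std (map τ pos)) (map (marked ι) pos)

allSubsets : (n : ℕ) → List (Subset n)
allSubsets zero = [] ∷ []
allSubsets (suc n) = concatMap (λ S → (false ∷ S) ∷ (true ∷ S) ∷ []) (allSubsets n)

compl : {k n : ℕ} → (Fin k → Fin n) → Subset n
compl ι = tabulate (λ i → not (marked ι i))

_⊆ᵇ_ : {n : ℕ} → Subset n → Subset n → Bool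
[] ⊆ᵇ [] = true
(x ∷ S) ⊆ᵇ (y ∷ T) = (not x ∨ y) ∧ (S ⊆ᵇ T)

subsetsOfC : {k n : ℕ} → (Fin k → Fin n) → List (Subset n)
subsetsOfC {n = n} ι = filterᵇ (λ S → S ⊆ᵇ compl ι) (allSubsets n)

elems : {k n : ℕ} → (Fin n → ℕ) → (Fin k → Fin n) → List Obj
elems τ ι = deduplicate _≟Obj_ (map (occPlus τ ι) (subsetsOfC ι))

leq : {k n : ℕ} → (Fin n → ℕ) → (Fin k → Fin n) → Obj → Obj → Bool
leq τ ι ρ π =
  any (λ S → any (λ S' → (S ⊆ᵇ S') ∧ ⌊ occPlus τ ι S ≟Obj ρ ⌋ ∧ ⌊ occPlus τ ι S' ≟Obj π ⌋)
                 (subsetsOfC ι))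
      (subsetsOfC ι)

-- Möbius function of a finite poset given by a duplicate-free list of
-- its elements and a boolean order relation:
--   μ(s,s) = 1,  μ(s,t) = - Σ_{s ≤ x < t} μ(s,x)  (s < t),  μ(s,t) = 0 otherwise.
-- The recursion is done with fuel; fuel (length of the element list + 1)
-- exceeds the length of any strict chain, so it never runs out.

sumℤ : List ℤ → ℤ
sumℤ = foldr _+ℤ_ (ℤ.pos 0)
  where open import Data.Integer using (ℤ)

module Möbius {A : Set} (_≟_ : DecidableEquality A) (E : List A) (_≤ᵇ_ : A → A → Bool) where

  μ-fuel : ℕ → A → A → ℤ
  μ-fuel zero s t = ℤ.pos 0
  μ-fuel (suc f) s t =
    if ⌊ s ≟ t ⌋ then ℤ.pos 1
    else if s ≤ᵇ t
      then - sumℤ (map (μ-fuel f s)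
                       (filterᵇ (λ x → (s ≤ᵇ x) ∧ (x ≤ᵇ t) ∧ not ⌊ x ≟ t ⌋) E))
      else ℤ.pos 0

  μ : A → A → ℤ
  μ = μ-fuel (suc (length E))

μOcc : {k n : ℕ} → (Fin n → ℕ) → (Fin k → Fin n) → ℤ
μOcc {n = n} τ ι =
  Möbius.μ _≟Obj_ (elems τ ι) (leq τ ι) (occPlus τ ι ⊥) (occPlus τ ι (compl ι))

{-# OPTIONS --safe #-}
module Submission where

-- Fix the block I, and consider the elements t = ⟨σ⟩ + S such that S contains at least two letters of I;
-- the maximum is one of them, and μ(⟨σ⟩,t) = 0 is shown for all of them by induction. Let t′ be t with S ∩ I
-- shrunk to a single letter; it does not matter which one, since no other letter of τ separates letters of I
-- by position or by value. An element x = ⟨σ⟩ + U below t with U ⊆ S either has two letters of I in U, and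
-- then μ(⟨σ⟩,x) = 0 by induction (if x ≠ t), or satisfies x ≤ t′. Hence
-- μ(⟨σ⟩,t) = −Σ_{x≤t′} μ(⟨σ⟩,x), which is 0 because t′ ≠ ⟨σ⟩.

open import Defs
open import Data.Bool using (Bool; true; false; T; not; _∧_; _∨_; if_then_else_)
open import Data.Bool.ListAction using (any)
open import Data.Bool.Properties using (T-∧; T-∨; T?)
open import Data.Empty using (⊥-elim)
open import Data.Fin as Fin using (Fin; zero; suc; toℕ)
import Data.Fin.Properties as Fin
open import Data.Fin.Subset using (Subset) renaming (⊥ to ∅)
open import Data.Integer using (ℤ; 0ℤ; -_) renaming (_+_ to _+ℤ_)
import Data.Integer.Properties as ℤ
open import Data.List using (List; []; _∷_; map; filterᵇ; length; allFin; zip)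
import Data.List.Membership.DecPropositional as DecMembership
open import Data.List.Membership.Propositional using (_∈_; find; lose)
open import Data.List.Membership.Propositional.Properties using (∈-map⁺; ∈-map⁻; ∈-filter⁺; ∈-filter⁻; ∈-allFin; ∈-concatMap⁺; ∈-deduplicate⁺; ∈-deduplicate⁻)
open import Data.List.Properties using (length-filter; length-map; map-∘; map-id; map-cong; map-cong-local; ∷-injective)
open import Data.List.Relation.Unary.All as All using (All; []; _∷_)
open import Data.List.Relation.Unary.AllPairs as AllPairs using (AllPairs; []; _∷_)
import Data.List.Relation.Unary.AllPairs.Properties as AllPairs
open import Data.List.Relation.Unary.Any using (here; there)
open import Data.List.Relation.Unary.Any.Properties using (any⁺; any⁻)
open import Data.List.Relation.Unary.Unique.DecPropositional.Properties using (deduplicate-!)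
open import Data.List.Relation.Unary.Unique.Propositional using (Unique)
open import Data.Nat using (ℕ; zero; suc; _+_; _≤_; _<_; _<ᵇ_; z≤n; s≤s; s≤s⁻¹)
import Data.Nat.Properties as ℕ
open import Data.Product using (_×_; _,_; ∃-syntax; proj₁; proj₂)
open import Data.Product.Properties using (,-injective)
open import Data.Sum using (_⊎_; inj₁; inj₂; map₂)
open import Data.Vec using (lookup; tabulate; []; _∷_)
open import Data.Vec.Properties using (lookup∘tabulate)
open import Function using (_∘_; _⇔_; mk⇔; id)
open import Function.Bundles using (Equivalence)
open import Level using (0ℓ)
open import Relation.Binary using (Rel; Asymmetric; DecidableEquality)
open import Relation.Binary.PropositionalEquality using (_≡_; _≢_; refl; sym; trans; cong; cong₂; subst; subst₂; module ≡-Reasoning)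
open import Relation.Nullary using (¬_; Dec; yes; no; contradiction)
open import Relation.Nullary.Decidable using (⌊_⌋; toWitness; fromWitness; ¬?; _×-dec_)
open Equivalence using (to; from)

-- Booleans, filtered lists and counting.

private variable A B : Set

T-ext : ∀ {a b} → (T a → T b) → (T b → T a) → a ≡ b
T-ext {true}  {true}  _ _ = refl
T-ext {true}  {false} f _ = ⊥-elim (f _)
T-ext {false} {true}  _ g = ⊥-elim (g _)
T-ext {false} {false} _ _ = refl

T-∧⁺ : ∀ {a b} → T a → T b → T (a ∧ b)
T-∧⁺ p q = from T-∧ (p , q)

T-∧⁻ : ∀ {a b} → T (a ∧ b) → T a × T b
T-∧⁻ = to T-∧

T-not⁺ : ∀ {a} → ¬ T a → T (not a)
T-not⁺ {true}  f = ⊥-elim (f _)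
T-not⁺ {false} _ = _

T-not⁻ : ∀ {a} → T (not a) → ¬ T a
T-not⁻ {false} _ ()

count : (A → Bool) → List A → ℕ
count p xs = length (filterᵇ p xs)

filterᵇ-cong : ∀ {p q : A → Bool} xs → (∀ {x} → x ∈ xs → p x ≡ q x) → filterᵇ p xs ≡ filterᵇ q xs
filterᵇ-cong [] _ = refl
filterᵇ-cong {p = p} {q} (x ∷ xs) e with p x | q x | e (here refl)
... | true  | .true  | refl = cong (x ∷_) (filterᵇ-cong xs (e ∘ there))
... | false | .false | refl = filterᵇ-cong xs (e ∘ there)

filterᵇ-map : ∀ (p : B → Bool) (f : A → B) xs → filterᵇ p (map f xs) ≡ map f (filterᵇ (p ∘ f) xs)
filterᵇ-map p f [] = refl
filterᵇ-map p f (x ∷ xs) with p (f x)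
... | true  = cong (f x ∷_) (filterᵇ-map p f xs)
... | false = filterᵇ-map p f xs

count-mono-≤ : ∀ {p q : A → Bool} xs → (∀ {x} → x ∈ xs → T (p x) → T (q x)) → count p xs ≤ count q xs
count-mono-≤ [] _ = z≤n
count-mono-≤ {p = p} {q} (x ∷ xs) e with p x | q x | e (here refl)
... | true  | true  | _ = s≤s (count-mono-≤ xs (e ∘ there))
... | true  | false | f = ⊥-elim (f _)
... | false | true  | _ = ℕ.m≤n⇒m≤1+n (count-mono-≤ xs (e ∘ there))
... | false | false | _ = count-mono-≤ xs (e ∘ there)

count-mono-< : ∀ {p q : A → Bool} xs → (∀ {x} → x ∈ xs → T (p x) → T (q x)) →
  ∀ {y} → y ∈ xs → T (q y) → ¬ T (p y) → count p xs < count q xs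
count-mono-< {p = p} {q} (x ∷ xs) e (here refl) qy ¬py with p x | q x
... | true  | _    = ⊥-elim (¬py _)
... | false | true = s≤s (count-mono-≤ xs (e ∘ there))
count-mono-< {p = p} {q} (x ∷ xs) e (there y∈) qy ¬py with p x | q x | e (here refl)
... | true  | true  | _ = s≤s (count-mono-< xs (e ∘ there) y∈ qy ¬py)
... | true  | false | f = ⊥-elim (f _)
... | false | true  | _ = ℕ.m≤n⇒m≤1+n (count-mono-< xs (e ∘ there) y∈ qy ¬py)
... | false | false | _ = count-mono-< xs (e ∘ there) y∈ qy ¬py

-- Integer sums over filtered lists.

sumOn : (A → Bool) → (A → ℤ) → List A → ℤ
sumOn p g xs = sumℤ (map g (filterᵇ p xs))

sumOn-cong : ∀ {p q : A → Bool} {g h : A → ℤ} xs → (∀ {x} → x ∈ xs → p x ≡ q x) →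
  (∀ {x} → x ∈ xs → T (q x) → g x ≡ h x) → sumOn p g xs ≡ sumOn q h xs
sumOn-cong [] _ _ = refl
sumOn-cong {p = p} {q} (x ∷ xs) e d with p x | q x | e (here refl) | d (here refl)
... | true  | .true  | refl | f = cong₂ _+ℤ_ (f _) (sumOn-cong xs (e ∘ there) (d ∘ there))
... | false | .false | refl | _ = sumOn-cong xs (e ∘ there) (d ∘ there)

sumOn-zero : ∀ {p : A → Bool} {g : A → ℤ} xs → (∀ {x} → x ∈ xs → T (p x) → g x ≡ 0ℤ) → sumOn p g xs ≡ 0ℤ
sumOn-zero [] _ = refl
sumOn-zero {p = p} (x ∷ xs) e with p x | e (here refl)
... | true  | f = cong₂ _+ℤ_ (f _) (sumOn-zero xs (e ∘ there))
... | false | _ = sumOn-zero xs (e ∘ there)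

sumOn-split : ∀ (p q : A → Bool) (g : A → ℤ) xs →
  sumOn p g xs ≡ sumOn (λ x → p x ∧ q x) g xs +ℤ sumOn (λ x → p x ∧ not (q x)) g xs
sumOn-split p q g [] = refl
sumOn-split p q g (x ∷ xs) with p x | q x
... | true  | true  = trans (cong (g x +ℤ_) (sumOn-split p q g xs)) (sym (ℤ.+-assoc (g x) _ _))
... | true  | false = begin
  g x +ℤ sumOn p g xs ≡⟨ cong (g x +ℤ_) (sumOn-split p q g xs) ⟩
  g x +ℤ (s +ℤ r)     ≡⟨ sym (ℤ.+-assoc (g x) s r) ⟩
  (g x +ℤ s) +ℤ r     ≡⟨ cong (_+ℤ r) (ℤ.+-comm (g x) s) ⟩
  (s +ℤ g x) +ℤ r     ≡⟨ ℤ.+-assoc s (g x) r ⟩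
  s +ℤ (g x +ℤ r)     ∎
  where
  open ≡-Reasoning
  s = sumOn (λ x → p x ∧ q x) g xs
  r = sumOn (λ x → p x ∧ not (q x)) g xs
... | false | _     = sumOn-split p q g xs

sumOn-single : ∀ {p : A → Bool} {g : A → ℤ} {t} {xs} → Unique xs → t ∈ xs →
  T (p t) → (∀ {x} → x ∈ xs → T (p x) → x ≡ t) → sumOn p g xs ≡ g t
sumOn-single {p = p} {g} {xs = x ∷ xs} (x# ∷ _) (here refl) pt e with p x
... | true = trans (cong (g x +ℤ_) (sumOn-zero xs λ y∈ py → contradiction (sym (e (there y∈) py)) (All.lookup x# y∈)))
                   (ℤ.+-identityʳ (g x))
sumOn-single {p = p} {xs = x ∷ xs} (x# ∷ u) (there t∈) pt e with p x | e (here refl)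
... | true  | f = contradiction (f _) (All.lookup x# t∈)
... | false | _ = sumOn-single u t∈ pt (e ∘ there)

-- A vanishing criterion for the Möbius function of a finite poset with minimum.

module MöbiusVanishing
  {A : Set} (_≟_ : DecidableEquality A) (E : List A) (_≤ᵇ_ : A → A → Bool)
  (E-unique : Unique E)
  (≤-refl : ∀ {x} → x ∈ E → T (x ≤ᵇ x))
  (≤-trans : ∀ {x y z} → T (x ≤ᵇ y) → T (y ≤ᵇ z) → T (x ≤ᵇ z))
  (≤-antisym : ∀ {x y} → T (x ≤ᵇ y) → T (y ≤ᵇ x) → x ≡ y)
  (⊥ : A) (⊥-least : ∀ {x} → x ∈ E → T (⊥ ≤ᵇ x))
  where

  open Möbius _≟_ E _≤ᵇ_

  -- Literally the filter predicate of `μ-fuel` at `s = ⊥`, so that unfolding the recursion once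
  -- yields a `sumOn` by computation.
  _≺ᵇ_ : A → A → Bool
  x ≺ᵇ t = (⊥ ≤ᵇ x) ∧ (x ≤ᵇ t) ∧ not ⌊ x ≟ t ⌋

  ≺ᵇ⁺ : ∀ {x t} → x ∈ E → T (x ≤ᵇ t) → x ≢ t → T (x ≺ᵇ t)
  ≺ᵇ⁺ x∈ x≤t x≢t = T-∧⁺ (⊥-least x∈) (T-∧⁺ x≤t (T-not⁺ (x≢t ∘ toWitness)))

  ≺ᵇ⁻ : ∀ {x t} → T (x ≺ᵇ t) → T (x ≤ᵇ t) × x ≢ t
  ≺ᵇ⁻ {x} {t} h with T-∧⁻ {x ≤ᵇ t} (proj₂ (T-∧⁻ {⊥ ≤ᵇ x} h))
  ... | x≤t , n = x≤t , λ e → T-not⁻ {⌊ x ≟ t ⌋} n (fromWitness e)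

  -- Measures both the fuel that `μ-fuel` needs at `t` and the progress of the induction in
  -- `μ-vanishes`.
  rank : A → ℕ
  rank t = count (_≤ᵇ t) E

  rank-mono : ∀ {x t} → t ∈ E → T (x ≺ᵇ t) → rank x < rank t
  rank-mono t∈ x<t with ≺ᵇ⁻ x<t
  ... | x≤t , x≢t = count-mono-< E (λ _ y≤x → ≤-trans y≤x x≤t) t∈ (≤-refl t∈) (x≢t ∘ ≤-antisym x≤t)

  0<rank : ∀ {t} → t ∈ E → 0 < rank t
  0<rank t∈ = ℕ.≤-<-trans z≤n (count-mono-< {p = λ _ → false} E (λ _ ()) t∈ (≤-refl t∈) λ ())

  μ-fuel-suc : ∀ f {t} → t ∈ E → ⊥ ≢ t → μ-fuel (suc f) ⊥ t ≡ - sumOn (_≺ᵇ t) (μ-fuel f ⊥) E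
  μ-fuel-suc f {t} t∈ ⊥≢t with ⊥ ≟ t | ⊥ ≤ᵇ t | ⊥-least t∈
  ... | yes e | _    | _ = contradiction e ⊥≢t
  ... | no _  | true | _ = refl

  -- The recursion only visits elements of strictly smaller rank, so `rank t` units of fuel suffice
  -- and a surplus changes nothing.
  μ-fuel-irrelevant : ∀ f g {t} → t ∈ E → rank t ≤ f → rank t ≤ g → μ-fuel f ⊥ t ≡ μ-fuel g ⊥ t
  -- `t` counts itself, so its rank is positive and fuel zero cannot occur.
  μ-fuel-irrelevant zero    _       t∈ r≤f _   = contradiction (ℕ.≤-trans (0<rank t∈) r≤f) λ ()
  μ-fuel-irrelevant (suc _) zero    t∈ _   r≤g = contradiction (ℕ.≤-trans (0<rank t∈) r≤g) λ ()
  μ-fuel-irrelevant (suc f) (suc g) {t} t∈ r≤f r≤g with ⊥ ≟ t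
  ... | yes _ = refl
  ... | no _  = cong (λ s → if ⊥ ≤ᵇ t then - s else 0ℤ) sums
    where
    sums : sumOn (_≺ᵇ t) (μ-fuel f ⊥) E ≡ sumOn (_≺ᵇ t) (μ-fuel g ⊥) E
    sums = sumOn-cong E (λ _ → refl) λ x∈ x<t → μ-fuel-irrelevant f g x∈
      (s≤s⁻¹ (ℕ.≤-trans (rank-mono t∈ x<t) r≤f)) (s≤s⁻¹ (ℕ.≤-trans (rank-mono t∈ x<t) r≤g))

  -- `μ` starts with fuel `suc (length E)`. One unfolding leaves `length E`, which still bounds
  -- every rank, so the summands are again values of `μ`.
  μ-recurrence : ∀ {t} → t ∈ E → ⊥ ≢ t → μ ⊥ t ≡ - sumOn (_≺ᵇ t) (μ ⊥) E
  μ-recurrence t∈ ⊥≢t = trans (μ-fuel-suc (length E) t∈ ⊥≢t) (cong -_ (sumOn-cong E (λ _ → refl) λ x∈ _ →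
    μ-fuel-irrelevant (length E) (suc (length E)) x∈ (rank≤ _) (ℕ.m≤n⇒m≤1+n (rank≤ _))))
    where
    rank≤ : ∀ t → rank t ≤ length E
    rank≤ t = length-filter (λ x → T? (x ≤ᵇ t)) E

  -- The summand at `x = t` is split off; the recurrence makes it the negative of the rest.
  Σμ≡0 : ∀ {t} → t ∈ E → ⊥ ≢ t → sumOn (_≤ᵇ t) (μ ⊥) E ≡ 0ℤ
  Σμ≡0 {t} t∈ ⊥≢t = begin
    sumOn (_≤ᵇ t) (μ ⊥) E                             ≡⟨ sumOn-split (_≤ᵇ t) (λ x → ⌊ x ≟ t ⌋) (μ ⊥) E ⟩
    sumOn (λ x → (x ≤ᵇ t) ∧ ⌊ x ≟ t ⌋) (μ ⊥) E +ℤ sumOn (λ x → (x ≤ᵇ t) ∧ not ⌊ x ≟ t ⌋) (μ ⊥) E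
      ≡⟨ cong₂ _+ℤ_ (sumOn-single E-unique t∈ (T-∧⁺ (≤-refl t∈) (fromWitness refl)) λ {x} _ h → toWitness (proj₂ (T-∧⁻ {x ≤ᵇ t} h)))
           -- `≺ᵇ` also asks for `⊥ ≤ᵇ x`, which holds throughout `E`.
           (sumOn-cong E (λ {x} x∈ → T-ext (T-∧⁺ (⊥-least x∈)) (λ h → proj₂ (T-∧⁻ {⊥ ≤ᵇ x} h))) λ _ _ → refl) ⟩
    μ ⊥ t +ℤ sumOn (_≺ᵇ t) (μ ⊥) E                    ≡⟨ cong (_+ℤ sumOn (_≺ᵇ t) (μ ⊥) E) (μ-recurrence t∈ ⊥≢t) ⟩
    - sumOn (_≺ᵇ t) (μ ⊥) E +ℤ sumOn (_≺ᵇ t) (μ ⊥) E  ≡⟨ ℤ.+-inverseˡ (sumOn (_≺ᵇ t) (μ ⊥) E) ⟩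
    0ℤ                                                ∎
    where open ≡-Reasoning

  -- The elements of Z below t contribute 0 by induction, so Σ_{x<t} μ(⊥,x) = Σ_{x≤t′} μ(⊥,x) = 0.
  μ-vanishes : (Z : A → Set) →
    (∀ {t} → t ∈ E → Z t → ∃[ t′ ] t′ ∈ E × T (t′ ≤ᵇ t) × t′ ≢ t × t′ ≢ ⊥ ×
      (∀ {x} → x ∈ E → T (x ≤ᵇ t) → Z x ⊎ T (x ≤ᵇ t′))) →
    ∀ {t} → t ∈ E → Z t → μ ⊥ t ≡ 0ℤ
  μ-vanishes Z step {t} t∈ = go (rank t) t∈ ℕ.≤-refl
    where
    -- `r` bounds the rank of `t` and makes the induction structural.
    go : ∀ r {t} → t ∈ E → rank t ≤ r → Z t → μ ⊥ t ≡ 0ℤ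
    go zero    t∈ r≤ _ = contradiction (ℕ.≤-trans (0<rank t∈) r≤) λ ()
    go (suc r) {t} t∈ r≤ zt with step t∈ zt
    ... | t′ , t′∈ , t′≤t , t′≢t , t′≢⊥ , split = trans (μ-recurrence t∈ ⊥≢t) (cong -_ sum≡0)
      where
      open ≡-Reasoning
      ⊥≢t : ⊥ ≢ t
      ⊥≢t refl = t′≢⊥ (≤-antisym t′≤t (⊥-least t′∈))
      -- Since `t′` lies strictly below `t`, this part of the sum is the full sum over `x ≤ t′`.
      low : ∀ {x} → x ∈ E → (x ≺ᵇ t) ∧ (x ≤ᵇ t′) ≡ (x ≤ᵇ t′)
      low {x} x∈ = T-ext (λ h → proj₂ (T-∧⁻ {x ≺ᵇ t} h)) λ x≤t′ →
        T-∧⁺ (≺ᵇ⁺ x∈ (≤-trans x≤t′ t′≤t) λ { refl → t′≢t (≤-antisym t′≤t x≤t′) }) x≤t′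
      high : ∀ {x} → x ∈ E → T ((x ≺ᵇ t) ∧ not (x ≤ᵇ t′)) → μ ⊥ x ≡ 0ℤ
      high {x} x∈ h with T-∧⁻ {x ≺ᵇ t} h
      ... | x<t , x≰t′ with split x∈ (proj₁ (≺ᵇ⁻ x<t))
      ... | inj₁ zx   = go r x∈ (s≤s⁻¹ (ℕ.≤-trans (rank-mono t∈ x<t) r≤)) zx
      ... | inj₂ x≤t′ = contradiction x≤t′ (T-not⁻ x≰t′)
      sum≡0 : sumOn (_≺ᵇ t) (μ ⊥) E ≡ 0ℤ
      sum≡0 = begin
        sumOn (_≺ᵇ t) (μ ⊥) E       ≡⟨ sumOn-split (_≺ᵇ t) (_≤ᵇ t′) (μ ⊥) E ⟩
        _                           ≡⟨ cong₂ _+ℤ_ (sumOn-cong E low λ _ _ → refl) (sumOn-zero E high) ⟩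
        sumOn (_≤ᵇ t′) (μ ⊥) E +ℤ 0ℤ ≡⟨ ℤ.+-identityʳ _ ⟩
        sumOn (_≤ᵇ t′) (μ ⊥) E      ≡⟨ Σμ≡0 t′∈ (t′≢⊥ ∘ sym) ⟩
        0ℤ                          ∎

-- Sorted lists, subsets and paired lists.

sorted-ext : {_<_ : Rel A 0ℓ} → Asymmetric _<_ → ∀ {xs ys : List A} → AllPairs _<_ xs → AllPairs _<_ ys →
  (∀ {z} → z ∈ xs → z ∈ ys) → (∀ {z} → z ∈ ys → z ∈ xs) → xs ≡ ys
sorted-ext asym [] [] _ _ = refl
sorted-ext asym [] (_ ∷ _) _ g = contradiction (g (here refl)) λ ()
sorted-ext asym (_ ∷ _) [] f _ = contradiction (f (here refl)) λ ()
sorted-ext {_<_ = _<_} asym {x ∷ xs} {y ∷ ys} (x< ∷ xs↗) (y< ∷ ys↗) f g with x≡y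
  where
  x≡y : x ≡ y
  x≡y with f (here refl) | g (here refl)
  ... | here e   | _        = e
  ... | there _  | here e   = sym e
  -- Each head lies in the tail of the other list, hence strictly above the other head.
  ... | there x∈ | there y∈ = contradiction (All.lookup x< y∈) (asym (All.lookup y< x∈))
... | refl = cong (x ∷_) (sorted-ext asym xs↗ ys↗ (λ z∈ → tail (All.lookup x< z∈) (f (there z∈)))
                                                 (λ z∈ → tail (All.lookup y< z∈) (g (there z∈))))
  where
  tail : ∀ {z zs} → x < z → z ∈ x ∷ zs → z ∈ zs
  tail x<z (here refl) = contradiction x<z (asym x<z)
  tail _   (there z∈)  = z∈

⊆ᵇ⁺ : ∀ {n} (S R : Subset n) → (∀ i → T (lookup S i) → T (lookup R i)) → T (S ⊆ᵇ R)
⊆ᵇ⁺ [] [] _ = _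
⊆ᵇ⁺ (x ∷ S) (y ∷ R) f = T-∧⁺ {not x ∨ y} (head x y (f zero)) (⊆ᵇ⁺ S R (f ∘ suc))
  where
  head : ∀ x y → (T x → T y) → T (not x ∨ y)
  head true  _ g = g _
  head false _ _ = _

⊆ᵇ⁻ : ∀ {n} (S R : Subset n) → T (S ⊆ᵇ R) → ∀ i → T (lookup S i) → T (lookup R i)
⊆ᵇ⁻ (true ∷ S) (y ∷ R) h zero    _ = proj₁ (T-∧⁻ {y} h)
⊆ᵇ⁻ (x ∷ S)    (y ∷ R) h (suc i) s = ⊆ᵇ⁻ S R (proj₂ (T-∧⁻ {not x ∨ y} h)) i s

∈-allSubsets : ∀ {n} (S : Subset n) → S ∈ allSubsets n
∈-allSubsets []          = here refl
∈-allSubsets (false ∷ S) = ∈-concatMap⁺ _ (lose (∈-allSubsets S) (here refl))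
∈-allSubsets (true ∷ S)  = ∈-concatMap⁺ _ (lose (∈-allSubsets S) (there (here refl)))

lookup-tabulate-T⁺ : ∀ {n} (f : Fin n → Bool) {i} → T (f i) → T (lookup (tabulate f) i)
lookup-tabulate-T⁺ f {i} = subst T (sym (lookup∘tabulate f i))

lookup-tabulate-T⁻ : ∀ {n} (f : Fin n → Bool) {i} → T (lookup (tabulate f) i) → T (f i)
lookup-tabulate-T⁻ f {i} = subst T (lookup∘tabulate f i)

∅-empty : ∀ {n} (i : Fin n) → ¬ T (lookup ∅ i)
∅-empty (suc i) h = ∅-empty i h

zip-map-map : ∀ {A B C : Set} (f : A → B) (g : A → C) xs → zip (map f xs) (map g xs) ≡ map (λ x → f x , g x) xs
zip-map-map f g []       = refl
zip-map-map f g (x ∷ xs) = cong (_ ∷_) (zip-map-map f g xs)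

-- Records a matching by index as a list of pairs, the form in which isomorphisms between
-- subsequences are handled below.
map≡map⇒pairs : ∀ {A B C : Set} {f : A → C} {g : B → C} xs ys → map f xs ≡ map g ys →
  ∃[ zs ] map proj₁ zs ≡ xs × map proj₂ zs ≡ ys × (∀ {z} → z ∈ zs → f (proj₁ z) ≡ g (proj₂ z))
map≡map⇒pairs [] [] _ = [] , refl , refl , λ ()
map≡map⇒pairs (x ∷ xs) (y ∷ ys) e with ∷-injective e
... | h , t with map≡map⇒pairs xs ys t
... | zs , p , q , f = (x , y) ∷ zs , cong (x ∷_) p , cong (y ∷_) q , λ { (here refl) → h ; (there z∈) → f z∈ }

-- Standard forms of marked subsequences and order isomorphism.

module MarkedWord {A : Set} (val : A → ℕ) (mark : A → Bool) where

  rank : List A → A → ℕ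
  rank ps p = count (λ q → val q <ᵇ val p) ps

  -- The same object as in `occPlus`, but with ranks attached to the letters themselves instead of
  -- to a separate list of values.
  word : List A → Obj
  word ps = map (λ p → rank ps p , mark p) ps

  zip-std≡word : ∀ ps → zip (std (map val ps)) (map mark ps) ≡ word ps
  zip-std≡word ps = begin
    zip (std (map val ps)) (map mark ps) ≡⟨ cong (λ r → zip r (map mark ps)) (sym (map-∘ ps)) ⟩
    zip (map (λ p → count (_<ᵇ val p) (map val ps)) ps) (map mark ps)
      ≡⟨ cong (λ r → zip r (map mark ps)) (map-cong (λ p → count-map (_<ᵇ val p)) ps) ⟩
    zip (map (rank ps) ps) (map mark ps) ≡⟨ zip-map-map (rank ps) mark ps ⟩
    word ps ∎
    where
    open ≡-Reasoning
    count-map : ∀ r → count r (map val ps) ≡ count (r ∘ val) ps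
    count-map r = trans (cong length (filterᵇ-map r val ps)) (length-map val (filterᵇ (r ∘ val) ps))

  -- The list `zs` stands for two subsequences side by side, letters at the same index being
  -- matched.
  OrderIso : List (A × A) → Set
  OrderIso zs = (∀ {y z} → y ∈ zs → z ∈ zs → val (proj₁ y) < val (proj₁ z) ⇔ val (proj₂ y) < val (proj₂ z)) ×
                (∀ {z} → z ∈ zs → mark (proj₁ z) ≡ mark (proj₂ z))

  OrderIso⇒word≡ : ∀ {zs} → OrderIso zs → word (map proj₁ zs) ≡ word (map proj₂ zs)
  OrderIso⇒word≡ {zs} (iso , marks) = begin
    word (map proj₁ zs)                                             ≡⟨ sym (map-∘ zs) ⟩
    map (λ z → rank (map proj₁ zs) (proj₁ z) , mark (proj₁ z)) zs
      ≡⟨ map-cong-local (All.tabulate λ z∈ → cong₂ _,_ (ranks z∈) (marks z∈)) ⟩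
    map (λ z → rank (map proj₂ zs) (proj₂ z) , mark (proj₂ z)) zs   ≡⟨ map-∘ zs ⟩
    word (map proj₂ zs)                                             ∎
    where
    open ≡-Reasoning
    -- Both ranks become counts over the same list `zs`, on which the two predicates agree pair by
    -- pair.
    rank-map : ∀ (f : A × A → A) p → rank (map f zs) p ≡ count (λ y → val (f y) <ᵇ val p) zs
    rank-map f p = trans (cong length (filterᵇ-map _ f zs)) (length-map f (filterᵇ _ zs))
    ranks : ∀ {z} → z ∈ zs → rank (map proj₁ zs) (proj₁ z) ≡ rank (map proj₂ zs) (proj₂ z)
    ranks {z} z∈ = begin
      rank (map proj₁ zs) (proj₁ z)                         ≡⟨ rank-map proj₁ (proj₁ z) ⟩
      count (λ y → val (proj₁ y) <ᵇ val (proj₁ z)) zs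
        ≡⟨ cong length (filterᵇ-cong zs λ y∈ → T-ext
             (ℕ.<⇒<ᵇ ∘ to (iso y∈ z∈) ∘ ℕ.<ᵇ⇒< _ _) (ℕ.<⇒<ᵇ ∘ from (iso y∈ z∈) ∘ ℕ.<ᵇ⇒< _ _)) ⟩
      count (λ y → val (proj₂ y) <ᵇ val (proj₂ z)) zs       ≡⟨ sym (rank-map proj₂ (proj₂ z)) ⟩
      rank (map proj₂ zs) (proj₂ z)                         ∎

  rank-mono-≤ : ∀ ps {p q} → val p ≤ val q → rank ps p ≤ rank ps q
  rank-mono-≤ ps p≤q = count-mono-≤ ps λ _ h → ℕ.<⇒<ᵇ (ℕ.<-≤-trans (ℕ.<ᵇ⇒< _ _ h) p≤q)

  -- `p` itself is counted in the rank of `q` but not in its own.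
  rank-mono-< : ∀ ps {p q} → p ∈ ps → val p < val q → rank ps p < rank ps q
  rank-mono-< ps {p} p∈ p<q = count-mono-< ps (λ _ h → ℕ.<⇒<ᵇ (ℕ.<-trans (ℕ.<ᵇ⇒< _ _ h) p<q)) p∈ (ℕ.<⇒<ᵇ p<q)
    λ h → ℕ.<-irrefl refl (ℕ.<ᵇ⇒< (val p) (val p) h)

  rank-cancel-< : ∀ ps {p q} → rank ps p < rank ps q → val p < val q
  rank-cancel-< ps r<r = ℕ.≰⇒> λ q≤p → ℕ.<⇒≱ r<r (rank-mono-≤ ps q≤p)

  -- Within one list letters compare as their ranks do, and matched letters have equal ranks, so
  -- comparisons carry over in both directions.
  word≡⇒OrderIso : ∀ ps qs → word ps ≡ word qs → ∃[ zs ] map proj₁ zs ≡ ps × map proj₂ zs ≡ qs × OrderIso zs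
  word≡⇒OrderIso ps qs e with map≡map⇒pairs ps qs e
  ... | zs , refl , refl , h = zs , refl , refl ,
    (λ y∈ z∈ → mk⇔
      (λ lt → rank-cancel-< qs (subst₂ _<_ (ranks y∈) (ranks z∈) (rank-mono-< ps (∈-map⁺ proj₁ y∈) lt)))
      (λ lt → rank-cancel-< ps (subst₂ _<_ (sym (ranks y∈)) (sym (ranks z∈)) (rank-mono-< qs (∈-map⁺ proj₂ y∈) lt)))) ,
    λ z∈ → proj₂ (,-injective (h z∈))
    where
    ranks : ∀ {z} → z ∈ zs → rank ps (proj₁ z) ≡ rank qs (proj₂ z)
    ranks z∈ = proj₁ (,-injective (h z∈))

-- The occurrence poset as a finite poset with minimum.

module OccurrencePoset {k n : ℕ} (τ : Fin n → ℕ) (ι : Fin k → Fin n) where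

  open MarkedWord τ (marked ι)

  sel : Subset n → Fin n → Bool
  sel S i = lookup S i ∨ marked ι i

  pos : Subset n → List (Fin n)
  pos S = filterᵇ (sel S) (allFin n)

  occ : Subset n → Obj
  occ = occPlus τ ι

  occ≡word : ∀ S → occ S ≡ word (pos S)
  occ≡word S = zip-std≡word (pos S)

  length-occ : ∀ S → length (occ S) ≡ count (sel S) (allFin n)
  length-occ S = trans (cong length (occ≡word S)) (length-map _ (pos S))

  pos-sorted : ∀ S → AllPairs Fin._<_ (pos S)
  pos-sorted S = AllPairs.filter⁺ (T? ∘ sel S) (AllPairs.tabulate⁺-< id)

  ∈-pos⁺ : ∀ S {i} → T (sel S i) → i ∈ pos S
  ∈-pos⁺ S h = ∈-filter⁺ (T? ∘ sel S) (∈-allFin _) h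

  ∈-pos⁻ : ∀ S {i} → i ∈ pos S → T (sel S i)
  ∈-pos⁻ S h = proj₂ (∈-filter⁻ (T? ∘ sel S) {xs = allFin n} h)

  -- An increasing list is determined by its members; this identifies `pos S` with lists obtained by
  -- mapping or filtering.
  pos-unique : ∀ S {ps} → AllPairs Fin._<_ ps → (∀ {i} → T (sel S i) → i ∈ ps) → (∀ {i} → i ∈ ps → T (sel S i)) → pos S ≡ ps
  pos-unique S ps↗ f g = sorted-ext (λ {i} {j} → ℕ.<-asym {toℕ i}) (pos-sorted S) ps↗ (f ∘ ∈-pos⁻ S) (∈-pos⁺ S ∘ g)

  _⊑_ : Subset n → Subset n → Set
  S ⊑ R = ∀ i → T (lookup S i) → T (lookup R i)

  Unmarked : Subset n → Set
  Unmarked S = ∀ i → T (lookup S i) → ¬ T (marked ι i)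

  sel⁺ : ∀ S {i} → T (lookup S i) → T (sel S i)
  sel⁺ S {i} s = from (T-∨ {lookup S i}) (inj₁ s)

  sel-mono : ∀ {S R} → S ⊑ R → ∀ {i} → T (sel S i) → T (sel R i)
  sel-mono {S} {R} S⊑R {i} h with to (T-∨ {lookup S i}) h
  ... | inj₁ s = sel⁺ R (S⊑R i s)
  ... | inj₂ m = from (T-∨ {lookup R i}) (inj₂ m)

  ∈-subsetsOfC⁺ : ∀ {S} → Unmarked S → S ∈ subsetsOfC ι
  ∈-subsetsOfC⁺ {S} u = ∈-filter⁺ (λ S → T? (S ⊆ᵇ compl ι)) (∈-allSubsets S)
    (⊆ᵇ⁺ S (compl ι) λ i s → lookup-tabulate-T⁺ (not ∘ marked ι) (T-not⁺ (u i s)))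

  ∈-subsetsOfC⁻ : ∀ {S} → S ∈ subsetsOfC ι → Unmarked S
  ∈-subsetsOfC⁻ {S} S∈ i s = T-not⁻ (lookup-tabulate-T⁻ (not ∘ marked ι) {i}
    (⊆ᵇ⁻ S (compl ι) (proj₂ (∈-filter⁻ (λ S → T? (S ⊆ᵇ compl ι)) {xs = allSubsets n} S∈)) i s))

  ∈-elems⁺ : ∀ {S} → Unmarked S → occ S ∈ elems τ ι
  ∈-elems⁺ {S} u = ∈-deduplicate⁺ _≟Obj_ (∈-map⁺ occ (∈-subsetsOfC⁺ {S} u))

  ∈-elems⁻ : ∀ {x} → x ∈ elems τ ι → ∃[ S ] Unmarked S × x ≡ occ S
  ∈-elems⁻ x∈ with ∈-map⁻ occ (∈-deduplicate⁻ _≟Obj_ (map occ (subsetsOfC ι)) x∈)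
  ... | S , S∈ , e = S , ∈-subsetsOfC⁻ S∈ , e

  -- `leq` with its two witnesses exposed; `lower` is unmarked as a part of `upper`.
  record _≼_ (x y : Obj) : Set where
    constructor mk≼
    field
      lower upper : Subset n
      upper-unmarked : Unmarked upper
      lower⊑upper : lower ⊑ upper
      occ-lower : occ lower ≡ x
      occ-upper : occ upper ≡ y

  ≼⁺ : ∀ S R → Unmarked R → S ⊑ R → occ S ≼ occ R
  ≼⁺ S R u S⊑R = mk≼ S R u S⊑R refl refl

  related : Obj → Obj → Subset n → Subset n → Bool
  related x y S R = (S ⊆ᵇ R) ∧ ⌊ occ S ≟Obj x ⌋ ∧ ⌊ occ R ≟Obj y ⌋

  ≼⇒leq : ∀ {x y} → x ≼ y → T (leq τ ι x y)
  ≼⇒leq {x} {y} (mk≼ S R u S⊑R e e′) =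
    any⁺ (λ S → any (related x y S) (subsetsOfC ι)) (lose {x = S} (∈-subsetsOfC⁺ {S} λ i s → u i (S⊑R i s))
      (any⁺ (related x y S) (lose {x = R} (∈-subsetsOfC⁺ {R} u)
        (T-∧⁺ (⊆ᵇ⁺ S R S⊑R) (T-∧⁺ {⌊ occ S ≟Obj x ⌋} (fromWitness e) (fromWitness e′))))))

  leq⇒≼ : ∀ {x y} → T (leq τ ι x y) → x ≼ y
  leq⇒≼ {x} {y} h with find (any⁻ (λ S → any (related x y S) (subsetsOfC ι)) (subsetsOfC ι) h)
  ... | S , S∈ , h′ with find (any⁻ (related x y S) (subsetsOfC ι) h′)
  ... | R , R∈ , h″ with T-∧⁻ {S ⊆ᵇ R} h″
  ... | S⊆R , es with T-∧⁻ {⌊ occ S ≟Obj x ⌋} es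
  ... | e , e′ = mk≼ S R (∈-subsetsOfC⁻ R∈) (⊆ᵇ⁻ S R S⊆R) (toWitness e) (toWitness e′)

  -- Equal objects give an order isomorphism between the subsequences of `R` and `R′`, and `U` is
  -- the image of `S` under it. Different subsets may represent one element, and this is the means
  -- of changing representatives.
  transfer : ∀ {S R R′} → S ⊑ R → occ R ≡ occ R′ → ∃[ U ] U ⊑ R′ × Unmarked U × occ U ≡ occ S
  transfer {S} {R} {R′} S⊑R e
    with word≡⇒OrderIso (pos R) (pos R′) (trans (sym (occ≡word R)) (trans e (occ≡word R′)))
  ... | zs , pos₁ , pos₂ , iso , marks = U , U⊑R′ , Um , occU
    where
    open DecMembership Fin._≟_ using (_∈?_)
    chosen : Fin n × Fin n → Bool
    chosen z = sel S (proj₁ z)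
    ys : List (Fin n × Fin n)
    ys = filterᵇ chosen zs
    ∈-ys⁻ : ∀ {z} → z ∈ ys → z ∈ zs × T (chosen z)
    ∈-ys⁻ = ∈-filter⁻ (T? ∘ chosen)
    ws : List (Fin n)
    ws = map proj₂ ys
    -- Marked positions are left out of the image, since `occ` puts them back.
    f : Fin n → Bool
    f i = ⌊ i ∈? ws ⌋ ∧ not (marked ι i)
    U : Subset n
    U = tabulate f
    U⁻ : ∀ {i} → T (lookup U i) → i ∈ ws × ¬ T (marked ι i)
    U⁻ {i} h with T-∧⁻ {⌊ i ∈? ws ⌋} (lookup-tabulate-T⁻ f {i} h)
    ... | i∈ , nm = toWitness i∈ , T-not⁻ nm
    ws⊆R′ : ∀ {i} → i ∈ ws → T (sel R′ i)
    ws⊆R′ i∈ with ∈-map⁻ proj₂ i∈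
    ... | z , z∈ , refl = ∈-pos⁻ R′ (subst (_ ∈_) pos₂ (∈-map⁺ proj₂ (proj₁ (∈-ys⁻ z∈))))
    Um : Unmarked U
    Um i h = proj₂ (U⁻ h)
    U⊑R′ : U ⊑ R′
    U⊑R′ i h with U⁻ h
    ... | i∈ , nm with to (T-∨ {lookup R′ i}) (ws⊆R′ i∈)
    ... | inj₁ r = r
    ... | inj₂ m = contradiction m nm
    -- The isomorphism respects marks, so a marked position is matched with a marked one, which
    -- `sel S` always selects.
    marked⊆ws : ∀ {i} → T (marked ι i) → i ∈ ws
    marked⊆ws {i} m with ∈-map⁻ proj₂ (subst (i ∈_) (sym pos₂) (∈-pos⁺ R′ (from (T-∨ {lookup R′ i}) (inj₂ m))))
    ... | z , z∈ , refl = ∈-map⁺ proj₂ (∈-filter⁺ (T? ∘ chosen) z∈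
      (from (T-∨ {lookup S (proj₁ z)}) (inj₂ (subst T (sym (marks z∈)) m))))
    posU : pos U ≡ ws
    posU = pos-unique U
      (AllPairs.map⁺ (AllPairs.filter⁺ (T? ∘ chosen) (AllPairs.map⁻ (subst (AllPairs Fin._<_) (sym pos₂) (pos-sorted R′)))))
      fwd bwd
      where
      fwd : ∀ {i} → T (sel U i) → i ∈ ws
      fwd {i} h with to (T-∨ {lookup U i}) h
      ... | inj₁ u = proj₁ (U⁻ u)
      ... | inj₂ m = marked⊆ws m
      bwd : ∀ {i} → i ∈ ws → T (sel U i)
      bwd {i} i∈ with T? (marked ι i)
      ... | yes m = from (T-∨ {lookup U i}) (inj₂ m)
      ... | no nm = from (T-∨ {lookup U i}) (inj₁ (lookup-tabulate-T⁺ f (T-∧⁺ (fromWitness i∈) (T-not⁺ nm))))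
    posS : pos S ≡ map proj₁ ys
    posS = pos-unique S
      (AllPairs.map⁺ (AllPairs.filter⁺ (T? ∘ chosen) (AllPairs.map⁻ (subst (AllPairs Fin._<_) (sym pos₁) (pos-sorted R)))))
      fwd bwd
      where
      fwd : ∀ {i} → T (sel S i) → i ∈ map proj₁ ys
      fwd {i} h with ∈-map⁻ proj₁ (subst (i ∈_) (sym pos₁) (∈-pos⁺ R (sel-mono {S} {R} S⊑R h)))
      ... | z , z∈ , refl = ∈-map⁺ proj₁ (∈-filter⁺ (T? ∘ chosen) z∈ h)
      bwd : ∀ {i} → i ∈ map proj₁ ys → T (sel S i)
      bwd i∈ with ∈-map⁻ proj₁ i∈
      ... | z , z∈ , refl = proj₂ (∈-ys⁻ z∈)
    occU : occ U ≡ occ S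
    occU = begin
      occ U               ≡⟨ occ≡word U ⟩
      word (pos U)        ≡⟨ cong word posU ⟩
      -- The pairs in `ys` are taken from `zs`, so they inherit the isomorphism.
      word (map proj₂ ys) ≡⟨ sym (OrderIso⇒word≡ ((λ y∈ z∈ → iso (proj₁ (∈-ys⁻ y∈)) (proj₁ (∈-ys⁻ z∈))) ,
                                                  λ z∈ → marks (proj₁ (∈-ys⁻ z∈)))) ⟩
      word (map proj₁ ys) ≡⟨ cong word (sym posS) ⟩
      word (pos S)        ≡⟨ sym (occ≡word S) ⟩
      occ S               ∎
      where open ≡-Reasoning

  -- By `transfer`, the upper witness is exchanged for the prescribed `R`.
  ≼-occ⁻ : ∀ {x R} → x ≼ occ R → ∃[ U ] U ⊑ R × Unmarked U × occ U ≡ x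
  ≼-occ⁻ {R = R} (mk≼ S R₀ _ S⊑R₀ refl e) = transfer {S} {R₀} {R} S⊑R₀ e

  ≼-refl : ∀ {x} → x ∈ elems τ ι → x ≼ x
  ≼-refl x∈ = let S , u , e = ∈-elems⁻ x∈ in mk≼ S S u (λ _ s → s) (sym e) (sym e)

  -- The two relations may represent `y` by different subsets; the first is moved onto the
  -- representative in the second, and then inclusions compose.
  ≼-trans : ∀ {x y z} → x ≼ y → y ≼ z → x ≼ z
  ≼-trans x≼y (mk≼ S R u S⊑R refl e) =
    let U , U⊑S , _ , e′ = ≼-occ⁻ {R = S} x≼y in mk≼ U R u (λ i → S⊑R i ∘ U⊑S i) e′ e

  length-mono-≤ : ∀ {x y} → x ≼ y → length x ≤ length y
  length-mono-≤ (mk≼ S R _ S⊑R refl refl) = subst₂ _≤_ (sym (length-occ S)) (sym (length-occ R))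
    (count-mono-≤ (allFin n) λ _ → sel-mono {S} {R} S⊑R)

  length-mono-< : ∀ {S R} → S ⊑ R → ∀ {i} → T (sel R i) → ¬ T (sel S i) → length (occ S) < length (occ R)
  length-mono-< {S} {R} S⊑R {i} r ¬s = subst₂ _<_ (sym (length-occ S)) (sym (length-occ R))
    (count-mono-< (allFin n) (λ _ → sel-mono {S} {R} S⊑R) (∈-allFin i) r ¬s)

  -- A position selected by `R` but not by `S` would make `y` strictly longer than `x`, which
  -- `y ≼ x` forbids; so `S` and `R` select the same positions.
  ≼-antisym : ∀ {x y} → x ≼ y → y ≼ x → x ≡ y
  ≼-antisym (mk≼ S R _ S⊑R refl refl) R≼S = trans (occ≡word S) (trans (cong word pos≡) (sym (occ≡word R)))
    where
    R⊑S : ∀ {i} → T (sel R i) → T (sel S i)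
    R⊑S {i} r with T? (sel S i)
    ... | yes s = s
    ... | no ¬s = contradiction (length-mono-≤ R≼S) (ℕ.<⇒≱ (length-mono-< {S} {R} S⊑R r ¬s))
    pos≡ : pos S ≡ pos R
    pos≡ = filterᵇ-cong (allFin n) λ _ → T-ext (sel-mono {S} {R} S⊑R) R⊑S

  ∅-least : ∀ {x} → x ∈ elems τ ι → occ ∅ ≼ x
  ∅-least x∈ = let S , u , e = ∈-elems⁻ x∈ in mk≼ ∅ S u (λ i h → contradiction h (∅-empty i)) refl (sym e)

  leq-refl : ∀ {x} → x ∈ elems τ ι → T (leq τ ι x x)
  leq-refl = ≼⇒leq ∘ ≼-refl

  leq-trans : ∀ {x y z} → T (leq τ ι x y) → T (leq τ ι y z) → T (leq τ ι x z)
  leq-trans {x} {y} {z} p q = ≼⇒leq {x} {z} (≼-trans (leq⇒≼ {x} {y} p) (leq⇒≼ {y} {z} q))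

  leq-antisym : ∀ {x y} → T (leq τ ι x y) → T (leq τ ι y x) → x ≡ y
  leq-antisym {x} {y} p q = ≼-antisym (leq⇒≼ {x} {y} p) (leq⇒≼ {y} {x} q)

  leq-least : ∀ {x} → x ∈ elems τ ι → T (leq τ ι (occ ∅) x)
  leq-least = ≼⇒leq ∘ ∅-least

  elems-unique : Unique (elems τ ι)
  elems-unique = deduplicate-! _≟Obj_ (map occ (subsetsOfC ι))

-- Separated sets and the collapse of an unmarked block.

AllPairs-zip-All : ∀ {A : Set} {P : A → Set} {R : A → A → Set} {xs} → All P xs → AllPairs R xs →
  AllPairs (λ x y → P x × P y × R x y) xs
AllPairs-zip-All []         []         = []
AllPairs-zip-All (px ∷ pxs) (rx ∷ rxs) = All.zipWith (λ (py , r) → px , py , r) (pxs , rx) ∷ AllPairs-zip-All pxs rxs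

-- Being a block with respect to `key`, which will be the position (for a factor) and the value (for
-- a set of consecutive values).
Separated : {n : ℕ} → (Fin n → Set) → (Fin n → ℕ) → Set
Separated I key = ∀ {m p q} → ¬ I m → I p → I q → (key m < key p → key m < key q) × (key p < key m → key q < key m)

-- Keys from `a` to `b` occur only in `I`, so an outside letter below some member falls below `a`,
-- and one above some member exceeds `b`.
interval-separated : ∀ {n} {I : Fin n → Set} (key : Fin n → ℕ) a b →
  (∀ {i} → I i → a ≤ key i × key i ≤ b) → (∀ {i} → a ≤ key i → key i ≤ b → I i) → Separated I key
interval-separated key a b inside fill ¬m p q =
  (λ m<p → ℕ.<-≤-trans (ℕ.≰⇒> λ a≤m → ¬m (fill a≤m (ℕ.<⇒≤ (ℕ.<-≤-trans m<p (proj₂ (inside p)))))) (proj₁ (inside q))) ,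
  (λ p<m → ℕ.≤-<-trans (proj₂ (inside q)) (ℕ.≰⇒> λ m≤b → ¬m (fill (ℕ.<⇒≤ (ℕ.≤-<-trans (proj₁ (inside p)) p<m)) m≤b)))

module UnmarkedBlock {k n : ℕ} (τ : Fin n → ℕ) (ι : Fin k → Fin n)
  (I : Fin n → Set) (I? : ∀ i → Dec (I i)) (I-unmarked : ∀ {i} → I i → ¬ T (marked ι i))
  (I-positions : Separated I toℕ) (I-values : Separated I τ) where

  open OccurrencePoset τ ι
  open MarkedWord τ (marked ι)

  collapsed : Subset n → Fin n → Fin n → Bool
  collapsed S i j = (lookup S j ∧ not ⌊ I? j ⌋) ∨ ⌊ j Fin.≟ i ⌋

  -- For `i` in both `S` and `I`, this subset represents the element `t′` of the argument.
  collapse : Subset n → Fin n → Subset n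
  collapse S i = tabulate (collapsed S i)

  ∈-collapse⁺ˡ : ∀ S i {j} → T (lookup S j) → ¬ I j → T (lookup (collapse S i) j)
  ∈-collapse⁺ˡ S i {j} s ¬j = lookup-tabulate-T⁺ (collapsed S i) (from (T-∨ {lookup S j ∧ not ⌊ I? j ⌋})
    (inj₁ (T-∧⁺ s (T-not⁺ (¬j ∘ toWitness)))))

  ∈-collapse⁺ʳ : ∀ S i → T (lookup (collapse S i) i)
  ∈-collapse⁺ʳ S i = lookup-tabulate-T⁺ (collapsed S i) (from (T-∨ {lookup S i ∧ not ⌊ I? i ⌋}) (inj₂ (fromWitness {a? = i Fin.≟ i} refl)))

  ∈-collapse⁻ : ∀ S i {j} → T (lookup (collapse S i) j) → (T (lookup S j) × ¬ I j) ⊎ j ≡ i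
  ∈-collapse⁻ S i {j} h with to (T-∨ {lookup S j ∧ not ⌊ I? j ⌋}) (lookup-tabulate-T⁻ (collapsed S i) {j} h)
  ... | inj₂ e = inj₂ (toWitness e)
  ... | inj₁ c with T-∧⁻ {lookup S j} c
  ... | s , ¬j = inj₁ (s , T-not⁻ ¬j ∘ fromWitness)

  sel-collapse⁺ : ∀ S i {j} → T (sel S j) → ¬ I j → T (sel (collapse S i) j)
  sel-collapse⁺ S i {j} h ¬j with to (T-∨ {lookup S j}) h
  ... | inj₁ s = sel⁺ (collapse S i) (∈-collapse⁺ˡ S i s ¬j)
  ... | inj₂ m = from (T-∨ {lookup (collapse S i) j}) (inj₂ m)

  sel-collapse⁻ : ∀ S i {j} → T (sel (collapse S i) j) → (T (sel S j) × ¬ I j) ⊎ j ≡ i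
  sel-collapse⁻ S i {j} h with to (T-∨ {lookup (collapse S i) j}) h
  ... | inj₂ m = inj₁ (from (T-∨ {lookup S j}) (inj₂ m) , λ j∈ → I-unmarked j∈ m)
  ... | inj₁ c with ∈-collapse⁻ S i c
  ... | inj₁ (s , ¬j) = inj₁ (sel⁺ S s , ¬j)
  ... | inj₂ e        = inj₂ e

  -- The graph of the map that sends `l` to `i` and fixes the complement of `I`. As a relation it is
  -- inverted by swapping `l` and `i`, so one monotonicity lemma serves both directions.
  Moved : Fin n → Fin n → Fin n → Fin n → Set
  Moved l i j j′ = (j ≡ l × j′ ≡ i) ⊎ (¬ I j × j ≡ j′)

  Moved-sym : ∀ {l i j j′} → Moved l i j j′ → Moved i l j′ j
  Moved-sym (inj₁ (p , q))    = inj₁ (q , p)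
  Moved-sym (inj₂ (p , refl)) = inj₂ (p , refl)

  -- Separation settles the mixed cases: a fixed letter compares with `i` as it does with `l`.
  Moved-mono : ∀ {key l i} → Separated I key → I l → I i → ∀ {j j′ m m′} → Moved l i j j′ → Moved l i m m′ →
    key j < key m → key j′ < key m′
  Moved-mono sep l∈ i∈ (inj₁ (refl , refl)) (inj₁ (refl , refl)) lt = contradiction lt (ℕ.<-irrefl refl)
  Moved-mono sep l∈ i∈ (inj₁ (refl , refl)) (inj₂ (¬m , refl))   lt = proj₂ (sep ¬m l∈ i∈) lt
  Moved-mono sep l∈ i∈ (inj₂ (¬j , refl))   (inj₁ (refl , refl)) lt = proj₁ (sep ¬j l∈ i∈) lt
  Moved-mono sep l∈ i∈ (inj₂ (_ , refl))    (inj₂ (_ , refl))    lt = lt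

  -- Replacing `l` by `i` keeps the order of positions and the order of values, by the two
  -- separation hypotheses, and neither letter is marked.
  occ-collapse : ∀ S {l i} → I l → I i → occ (collapse S l) ≡ occ (collapse S i)
  occ-collapse S {l} {i} l∈ i∈ = begin
    occ (collapse S l)   ≡⟨ occ≡word (collapse S l) ⟩
    word ps              ≡⟨ cong word ps≡ ⟨
    word (map proj₁ zs)  ≡⟨ OrderIso⇒word≡ (iso , marks) ⟩
    word (map proj₂ zs)  ≡⟨ cong word qs≡ ⟨
    word (pos (collapse S i)) ≡⟨ occ≡word (collapse S i) ⟨
    occ (collapse S i)   ∎
    where
    open ≡-Reasoning
    φ : Fin n → Fin n
    φ j = if ⌊ j Fin.≟ l ⌋ then i else j
    ps : List (Fin n)
    ps = pos (collapse S l)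
    zs : List (Fin n × Fin n)
    zs = map (λ j → j , φ j) ps
    ps≡ : map proj₁ zs ≡ ps
    ps≡ = trans (sym (map-∘ ps)) (map-id ps)
    φ-l : φ l ≡ i
    φ-l with l Fin.≟ l
    ... | yes _ = refl
    ... | no ne = contradiction refl ne
    φ-fixed : ∀ {j} → ¬ I j → φ j ≡ j
    φ-fixed {j} ¬j with j Fin.≟ l
    ... | yes refl = contradiction l∈ ¬j
    ... | no _     = refl
    moved : ∀ {j} → j ∈ ps → Moved l i j (φ j)
    moved {j} j∈ with sel-collapse⁻ S l (∈-pos⁻ (collapse S l) j∈)
    ... | inj₁ (_ , ¬j) = inj₂ (¬j , sym (φ-fixed ¬j))
    ... | inj₂ refl     = inj₁ (refl , φ-l)
    moved-zs : ∀ {z} → z ∈ zs → Moved l i (proj₁ z) (proj₂ z)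
    moved-zs z∈ with ∈-map⁻ (λ j → j , φ j) z∈
    ... | _ , j∈ , refl = moved j∈
    iso : ∀ {y z} → y ∈ zs → z ∈ zs → τ (proj₁ y) < τ (proj₁ z) ⇔ τ (proj₂ y) < τ (proj₂ z)
    iso y∈ z∈ = mk⇔ (Moved-mono I-values l∈ i∈ (moved-zs y∈) (moved-zs z∈))
                    (Moved-mono I-values i∈ l∈ (Moved-sym (moved-zs y∈)) (Moved-sym (moved-zs z∈)))
    marks : ∀ {z} → z ∈ zs → marked ι (proj₁ z) ≡ marked ι (proj₂ z)
    marks z∈ with moved-zs z∈
    ... | inj₂ (_ , refl)    = refl
    ... | inj₁ (refl , refl) = T-ext (λ m → contradiction m (I-unmarked l∈)) (λ m → contradiction m (I-unmarked i∈))
    qs≡ : pos (collapse S i) ≡ map proj₂ zs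
    qs≡ = trans (pos-unique (collapse S i) sorted fwd bwd) (map-∘ ps)
      where
      -- Separation by position: `i` occupies the same place among the remaining letters as `l` did.
      sorted : AllPairs Fin._<_ (map φ ps)
      sorted = AllPairs.map⁺ (AllPairs.map (λ (p , q , lt) → Moved-mono I-positions l∈ i∈ p q lt)
        (AllPairs-zip-All (All.tabulate moved) (pos-sorted (collapse S l))))
      fwd : ∀ {j} → T (sel (collapse S i) j) → j ∈ map φ ps
      fwd {j} h with sel-collapse⁻ S i h
      ... | inj₁ (s , ¬j) = subst (_∈ map φ ps) (φ-fixed ¬j) (∈-map⁺ φ (∈-pos⁺ (collapse S l) (sel-collapse⁺ S l s ¬j)))
      ... | inj₂ refl     = subst (_∈ map φ ps) φ-l (∈-map⁺ φ (∈-pos⁺ (collapse S l) (sel⁺ (collapse S l) (∈-collapse⁺ʳ S l))))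
      bwd : ∀ {j} → j ∈ map φ ps → T (sel (collapse S i) j)
      bwd j∈ with ∈-map⁻ φ j∈
      ... | m , m∈ , refl with sel-collapse⁻ S l (∈-pos⁻ (collapse S l) m∈)
      ... | inj₁ (s , ¬m) = subst (T ∘ sel (collapse S i)) (sym (φ-fixed ¬m)) (sel-collapse⁺ S i s ¬m)
      ... | inj₂ refl     = subst (T ∘ sel (collapse S i)) (sym φ-l) (sel⁺ (collapse S i) (∈-collapse⁺ʳ S i))

  record MeetsTwice (S : Subset n) : Set where
    constructor twice
    field
      {first second} : Fin n
      distinct  : first ≢ second
      first∈S   : T (lookup S first)
      first∈I   : I first
      second∈S  : T (lookup S second)
      second∈I  : I second

  -- The induction runs over objects, and one object may have several representatives; it is enough
  -- that one of them meets `I` twice.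
  HasBlock : Obj → Set
  HasBlock x = ∃[ S ] Unmarked S × MeetsTwice S × x ≡ occ S

  collapse⊑ : ∀ {S i} → T (lookup S i) → collapse S i ⊑ S
  collapse⊑ {S} {i} i∈S j c with ∈-collapse⁻ S i c
  ... | inj₁ (s , _) = s
  ... | inj₂ refl    = i∈S

  ⊑-unmarked : ∀ U S → U ⊑ S → Unmarked S → Unmarked U
  ⊑-unmarked U S U⊑S u i h = u i (U⊑S i h)

  -- If `U` misses `I`, it lies in `collapse S i`. If it meets `I` in `l` alone, it lies in
  -- `collapse S l`, which gives the same object by `occ-collapse`.
  meetsTwice-or-collapses : ∀ {S U i} → Unmarked S → T (lookup S i) → I i → U ⊑ S →
    MeetsTwice U ⊎ occ U ≼ occ (collapse S i)
  meetsTwice-or-collapses {S} {U} {i} um i∈S i∈I U⊑S with Fin.any? (λ l → T? (lookup U l) ×-dec I? l)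
  ... | no none = inj₂ (≼⁺ U (collapse S i) (⊑-unmarked (collapse S i) S (collapse⊑ {S} i∈S) um)
          λ j u → ∈-collapse⁺ˡ S i (U⊑S j u) λ j∈I → none (j , u , j∈I))
  ... | yes (l , l∈U , l∈I) with Fin.any? (λ m → ¬? (l Fin.≟ m) ×-dec T? (lookup U m) ×-dec I? m)
  ... | yes (m , l≢m , m∈U , m∈I) = inj₁ (twice l≢m l∈U l∈I m∈U m∈I)
  ... | no none = inj₂ (mk≼ U (collapse S l) (⊑-unmarked (collapse S l) S (collapse⊑ {S} (U⊑S l l∈U)) um) U⊑ refl (occ-collapse S l∈I i∈I))
    where
    U⊑ : U ⊑ collapse S l
    U⊑ j u with l Fin.≟ j
    ... | yes refl = ∈-collapse⁺ʳ S l
    ... | no l≢j   = ∈-collapse⁺ˡ S l (U⊑S j u) λ j∈I → none (j , l≢j , u , j∈I)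

  -- Supplies what `μ-vanishes` asks for, with `t′` obtained by keeping only `i` from the block.
  HasBlock-step : ∀ {t} → HasBlock t → ∃[ t′ ] t′ ∈ elems τ ι × t′ ≼ t × t′ ≢ t × t′ ≢ occ ∅ ×
    (∀ {x} → x ≼ t → HasBlock x ⊎ x ≼ t′)
  HasBlock-step (S , um , twice {i} {j} i≢j i∈S i∈I j∈S j∈I , refl) =
    occ S′ , ∈-elems⁺ {S′} um′ , ≼⁺ S′ S um S′⊑S ,
    -- Lengths tell the objects apart: `j` is lost in passing from `S` to `S′`, and `i` is present
    -- in `S′` but not in the minimum.
    (λ e → ℕ.<⇒≢ (length-mono-< {S′} {S} S′⊑S (sel⁺ S j∈S) j∉S′) (cong length e)) ,
    (λ e → ℕ.<⇒≢ (length-mono-< {∅} {S′} (λ l h → contradiction h (∅-empty l)) (sel⁺ S′ (∈-collapse⁺ʳ S i)) i∉∅)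
             (cong length (sym e))) ,
    split
    where
    S′ : Subset n
    S′ = collapse S i
    S′⊑S : S′ ⊑ S
    S′⊑S = collapse⊑ {S} i∈S
    um′ : Unmarked S′
    um′ = ⊑-unmarked S′ S S′⊑S um
    j∉S′ : ¬ T (sel S′ j)
    j∉S′ h with sel-collapse⁻ S i h
    ... | inj₁ (_ , ¬j) = ¬j j∈I
    ... | inj₂ j≡i      = i≢j (sym j≡i)
    i∉∅ : ¬ T (sel ∅ i)
    i∉∅ h with to (T-∨ {lookup ∅ i}) h
    ... | inj₁ e = ∅-empty i e
    ... | inj₂ m = I-unmarked i∈I m
    split : ∀ {x} → x ≼ occ S → HasBlock x ⊎ x ≼ occ S′
    -- A representative of `x` inside `S` itself is needed before its letters in `I` can be counted.
    split x≼t with ≼-occ⁻ {R = S} x≼t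
    ... | U , U⊑S , umU , refl with meetsTwice-or-collapses {S} {U} um i∈S i∈I U⊑S
    ... | inj₁ m = inj₁ (U , umU , m , refl)
    ... | inj₂ l = inj₂ l

  μ-block : ∀ {S} → Unmarked S → MeetsTwice S → Möbius.μ _≟Obj_ (elems τ ι) (leq τ ι) (occ ∅) (occ S) ≡ 0ℤ
  μ-block {S} um m = MöbiusVanishing.μ-vanishes _≟Obj_ (elems τ ι) (leq τ ι) elems-unique
    leq-refl (λ {x} {y} {z} → leq-trans {x} {y} {z}) (λ {x} {y} → leq-antisym {x} {y}) (occ ∅) leq-least
    HasBlock step (∈-elems⁺ {S} um) (S , um , m , refl)
    where
    step : ∀ {t} → t ∈ elems τ ι → HasBlock t → ∃[ t′ ] t′ ∈ elems τ ι × T (leq τ ι t′ t) × t′ ≢ t × t′ ≢ occ ∅ ×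
      (∀ {x} → x ∈ elems τ ι → T (leq τ ι x t) → HasBlock x ⊎ T (leq τ ι x t′))
    step {t} _ b = let t′ , t′∈ , t′≼t , t′≢t , t′≢⊥ , split = HasBlock-step b in
      t′ , t′∈ , ≼⇒leq t′≼t , t′≢t , t′≢⊥ , λ {x} _ h → map₂ (≼⇒leq {x} {t′}) (split (leq⇒≼ {x} {t} h))

-- Interval blocks as unmarked separated sets with at least two letters.

theorem3p1 : (k n : ℕ) (σ : Fin k → ℕ) (τ : Fin n → ℕ) (ι : Fin k → Fin n) →
    IsPerm k σ → IsPerm n τ → IsOccurrence σ τ ι →
    HasIntervalBlock τ ι → μOcc τ ι ≡ 0ℤ
theorem3p1 k n σ τ ι _ (_ , τ-inj) _ (a , b , (1≤b , a+b<n , a′ , values-in , values-fill) , unmarked) =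
  -- The maximum is represented by `compl ι`, which contains the whole block because no letter of
  -- the block is marked.
  μ-block {compl ι} (λ i h → T-not⁻ (lookup-tabulate-T⁻ (not ∘ marked ι) {i} h))
    (twice first≢second (∈-compl first∈) first∈ (∈-compl second∈) second∈)
  where
  I : Fin n → Set
  I = InRange a b
  I-unmarked : ∀ {i} → I i → ¬ T (marked ι i)
  I-unmarked {i} i∈ = subst T (unmarked i i∈)
  I? : ∀ i → Dec (I i)
  I? i = (a ℕ.≤? toℕ i) ×-dec (toℕ i ℕ.≤? a + b)
  I-positions : Separated I toℕ
  I-positions = interval-separated toℕ a (a + b) id _,_
  I-values : Separated I τ
  -- A position whose value lies in the block's range shares that value with a position of the
  -- block, and `τ` is injective.
  I-values = interval-separated τ a′ (a′ + b) (λ {i} → values-in i) λ {i} lo hi →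
    let j , j∈ , τj≡τi = values-fill (τ i) lo hi in subst I (τ-inj j i τj≡τi) j∈
  open UnmarkedBlock τ ι I I? I-unmarked I-positions I-values
  ∈-compl : ∀ {i} → I i → T (lookup (compl ι) i)
  ∈-compl i∈ = lookup-tabulate-T⁺ (not ∘ marked ι) (T-not⁺ (I-unmarked i∈))
  a+1≤a+b : suc a ≤ a + b
  a+1≤a+b = subst (_≤ a + b) (ℕ.+-comm a 1) (ℕ.+-monoʳ-≤ a 1≤b)
  -- The positions `a` and `a + 1`; the latter is in the block because `1 ≤ b`.
  first second : Fin n
  first  = Fin.fromℕ< (ℕ.≤-<-trans (ℕ.m≤m+n a b) a+b<n)
  second = Fin.fromℕ< (ℕ.≤-<-trans a+1≤a+b a+b<n)
  toℕ-first : toℕ first ≡ a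
  toℕ-first = Fin.toℕ-fromℕ< _
  toℕ-second : toℕ second ≡ suc a
  toℕ-second = Fin.toℕ-fromℕ< _
  first∈ : I first
  first∈ = subst (λ m → a ≤ m × m ≤ a + b) (sym toℕ-first) (ℕ.≤-refl , ℕ.m≤m+n a b)
  second∈ : I second
  second∈ = subst (λ m → a ≤ m × m ≤ a + b) (sym toℕ-second) (ℕ.n≤1+n a , a+1≤a+b)
  first≢second : first ≢ second
  first≢second e = ℕ.1+n≢n (trans (sym toℕ-second) (trans (cong toℕ (sym e)) toℕ-first))
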